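{- Let $k\ge 0$ be an integer. There exists a killer-win graph (for the cop and killer game) with exactly $k$ triangles if and only if $k=0$ or $k\ge 3$.
   Context: Graphs are finite, simple and undirected; a triangle is a subgraph isomorphic to $C_3$. The cop and killer game on a graph $G$ is the following perfect-information game. First the cop picks a starting vertex, then the killer picks a starting vertex different from the cop's. Then the players alternate turns, the cop moving first; on each turn the player must move to a vertex adjacent to her/his current vertex (staying put is not allowed; a player on a vertex with no neighbours simply remains there). If after a move of the cop she occupies the killer's vertex, the cop wins; if after a move of the killer he occupies the cop's vertex, the killer wins; if neither ever happens, the game is a stalemate. $G$ is cop-win if the cop has a strategy that guarantees she wins, killer-win if the killer has a strategy that guarantees he wins, and stalemate if neither is the case. -}

module Defs where

open import Data.Fin using (Fin; _≟_)
open import Data.Fin.Subset using (Subset; _∈_)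
open import Data.List using (List; length)
import Data.List.Membership.Propositional as List
open import Data.List.NonEmpty using (List⁺; [_]; _∷⁺_; head)
open import Data.List.Relation.Unary.Unique.Propositional using (Unique)
open import Data.Nat using (ℕ; zero; suc; _≤_; NonZero)
open import Data.Product using (_×_; _,_; ∃; ∃-syntax; proj₁; proj₂)
open import Data.Sum using (_⊎_)
open import Data.Vec using (Vec; lookup)
open import Function.Bundles using (_⇔_)
open import Function.Definitions using (Injective)
open import Level using (0ℓ)
open import Relation.Binary using (Rel; Decidable; Symmetric)
open import Relation.Binary.PropositionalEquality using (_≡_; _≢_; refl; ≢-sym)
open import Relation.Nullary using (¬_)
open import Relation.Nullary.Decidable using (¬?)

-- Graphs have at least one vertex: on the empty graph the cop could not
-- choose a start, so the killer would win vacuously.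

record Graph : Set₁ where
  field
    order    : ℕ
    nonEmpty : NonZero order

  Vertex : Set
  Vertex = Fin order

  field
    _~_      : Rel Vertex 0ℓ
    _~?_     : Decidable _~_
    ~-sym    : Symmetric _~_
    ~-irrefl : ∀ v → ¬ (v ~ v)

-- On three vertices the cycle makes every two distinct vertices adjacent.

C₃ : Graph
C₃ = record
  { order    = 3
  ; nonEmpty = _
  ; _~_      = _≢_
  ; _~?_     = λ i j → ¬? (i ≟ j)
  ; ~-sym    = ≢-sym
  ; ~-irrefl = λ _ v≢v → v≢v refl
  }

-- A candidate subgraph on the vertices Fin n: a vertex set, and for each u
-- the set of its neighbours.  There are no proof components, so _≡_ is
-- equality of subgraphs and triangles can be counted up to _≡_.

record SubgraphData (n : ℕ) : Set where
  constructor ⟨_,_⟩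
  field
    vertices   : Subset n
    neighbours : Vec (Subset n) n

  Edge : Rel (Fin n) 0ℓ
  Edge u v = v ∈ lookup neighbours u

module _ (G : Graph) where
  open Graph G

  record IsSubgraph (H : SubgraphData order) : Set where
    open SubgraphData H
    field
      edge-sym : Symmetric Edge
      edge⇒∈   : ∀ {u v} → Edge u v → u ∈ vertices
      edge⇒~   : ∀ {u v} → Edge u v → u ~ v

-- An isomorphism from F onto H, as an injection into the ambient vertex type
-- whose image is the vertex set of H.

record _≅_ {n : ℕ} (F : Graph) (H : SubgraphData n) : Set where
  open Graph F
  open SubgraphData H
  field
    to        : Vertex → Fin n
    injective : Injective _≡_ _≡_ to
    image     : ∀ v → v ∈ vertices ⇔ (∃[ i ] to i ≡ v)
    edges     : ∀ i j → (i ~ j) ⇔ Edge (to i) (to j)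

module _ (G : Graph) where
  open Graph G

  IsTriangle : SubgraphData order → Set
  IsTriangle H = IsSubgraph G H × (C₃ ≅ H)

  HasExactlyTriangles : ℕ → Set
  HasExactlyTriangles k =
    ∃[ ts ] Unique ts × length ts ≡ k × (∀ H → (H List.∈ ts) ⇔ IsTriangle H)

  Move : Rel Vertex 0ℓ
  Move u v = (u ~ v) ⊎ ((∀ w → ¬ (u ~ w)) × v ≡ u)

  -- (cop's vertex , killer's vertex)

  Position : Set
  Position = Vertex × Vertex

  -- Positions at the end of each completed round, the latest first and the
  -- starting position last.

  History : Set
  History = List⁺ Position

  cop killer : History → Vertex
  cop    h = proj₁ (head h)
  killer h = proj₂ (head h)

  record CopStrategy : Set where
    field
      start : Vertex
      move  : (h : History) → ∃[ c ] Move (cop h) c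

  -- The second argument of move is the vertex to which the cop has just moved.

  record KillerStrategy : Set where
    field
      start : (c : Vertex) → ∃[ r ] r ≢ c
      move  : (h : History) (c : Vertex) → ∃[ r ] Move (killer h) r

  module _ (τ : CopStrategy) (σ : KillerStrategy) where
    private
      module τ = CopStrategy τ
      module σ = KillerStrategy σ

    -- The history after t rounds.  Moves are generated past a capture too;
    -- KillerWins only looks at the first capture.

    play : ℕ → History
    play zero    = [ τ.start , proj₁ (σ.start τ.start) ]
    play (suc t) = (c , proj₁ (σ.move (play t) c)) ∷⁺ play t
      where c = proj₁ (τ.move (play t))

    -- Captures in the round that follows play t.

    CopCaptures KillerCaptures : ℕ → Set
    CopCaptures    t = cop (play (suc t)) ≡ killer (play t)
    KillerCaptures t = killer (play (suc t)) ≡ cop (play (suc t))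

    -- In each round the cop moves first, hence s ≤ t rather than s < t.

    KillerWins : Set
    KillerWins = ∃[ t ] KillerCaptures t × (∀ s → s ≤ t → ¬ CopCaptures s)

  KillerWin : Set
  KillerWin = ∃[ σ ] (∀ τ → KillerWins τ σ)

{-# OPTIONS --safe #-}
module Submission where

open import Data.Bool using (true)
open import Data.Empty using (⊥)
open import Data.Fin using (Fin; zero; suc; _≟_; _<_; _≤_; fromℕ; inject₁; _↑ˡ_; _↑ʳ_)
open import Data.Fin.Patterns using (0F; 1F; 2F; 3F; 4F; 5F)
open import Data.Fin.Properties
  using (<-cmp; _<?_; ≤∧≢⇒<; all?; any?; pigeonhole; suc-injective; ↑ʳ-injective)
open import Data.Fin.Subset using (Subset; _∈_; ⁅_⁆; _∪_)
open import Data.Fin.Subset.Properties using (⊆-antisym; ∪⇔⊎; x∈⁅y⁆⇔x≡y)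
import Data.Fin.Subset.Properties as Subset
open import Data.List using (List; []; _∷_; length)
import Data.List as List
import Data.List.Membership.DecPropositional as DecMembership
import Data.List.Membership.Propositional as List
import Data.List.Membership.Propositional.Properties as List
open import Data.List.Properties using (length-tabulate)
open import Data.List.Relation.Unary.All as All using (All; []; _∷_)
import Data.List.Relation.Unary.All.Properties as All
open import Data.List.Relation.Unary.AllPairs using ([]; _∷_)
open import Data.List.Relation.Unary.Any using (here; there; index)
open import Data.List.Relation.Unary.Any.Properties using (lookup-index)
open import Data.List.Relation.Unary.Unique.Propositional using (Unique)
import Data.List.Relation.Unary.Unique.Propositional.Properties as Unique
open import Data.Nat using (ℕ; zero; suc; z≤n; s≤s; _+_; _≥_)
import Data.Nat as ℕ
import Data.Nat.Properties as ℕ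
open import Data.Product using (_×_; _,_; ∃; ∃-syntax; ∃₂; proj₁; proj₂)
open import Data.Product.Properties using (≡-dec)
open import Data.Sum using (_⊎_; inj₁; inj₂; [_,_]′)
import Data.Sum as Sum
open import Data.Vec using (Vec; []; _∷_; lookup; tabulate)
open import Data.Vec.Properties using (lookup∘tabulate; lookup⇒[]=; []=⇒lookup)
open import Data.Vec.Relation.Binary.Pointwise.Extensional using (ext; Pointwise-≡⇒≡)
open import Function using (_∘_; id)
open import Function.Bundles using (_⇔_; mk⇔; Equivalence)
open import Function.Definitions using (Injective)
open import Relation.Binary using (Decidable; tri<; tri≈; tri>)
open import Relation.Binary.PropositionalEquality
  using (_≡_; _≢_; refl; sym; trans; cong; subst; ≢-sym)
open import Relation.Nullary using (¬_; Dec; does; yes; no; contradiction)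
open import Relation.Nullary.Decidable
  using (_×-dec_; _⊎-dec_; _→-dec_; ¬?; dec-true; decidable-stable; from-yes)
open import Defs

-- In a graph with one or two triangles the cop survives by walking on a
-- triangle abc.  From a, with the killer r not adjacent to a, both b and c can
-- be unsafe only if rbc is a second triangle.  If there is a second triangle
-- dbc, the cop only has to avoid standing on a with the killer on d, and a
-- third triangle would be needed to force her there.
--
-- Conversely, the killer wins on the path P₄, which has no triangles, and on
-- the wheel with five spokes minus one spoke, which has three.  Replacing a
-- vertex by nonadjacent twins keeps a graph killer-win, and twins of a rim
-- vertex lying in a single triangle add one triangle each.

open Equivalence using () renaming (to to ⇒; from to ⇐)

-- Triangles as complete subgraphs on three corners.

private variable
  n : ℕ

does⇒ : {P : Set} (P? : Dec P) → does P? ≡ true → P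
does⇒ (yes p) _ = p

vec-ext : {A : Set} {xs ys : Vec A n} → (∀ i → lookup xs i ≡ lookup ys i) → xs ≡ ys
vec-ext = Pointwise-≡⇒≡ ∘ ext

IsCorner : (a b c x : Fin n) → Set
IsCorner a b c x = x ≡ a ⊎ x ≡ b ⊎ x ≡ c

Complete : SubgraphData n → Set
Complete H = ∀ {u v} → Edge u v ⇔ (u ∈ vertices × v ∈ vertices × u ≢ v)
  where open SubgraphData H

-- Opaque, so that the type checker compares triangles by their corners.

opaque
  corners : Fin n → Fin n → Fin n → Subset n
  corners a b c = ⁅ a ⁆ ∪ (⁅ b ⁆ ∪ ⁅ c ⁆)

  edge? : (p : Subset n) (u v : Fin n) → Dec (u ∈ p × v ∈ p × u ≢ v)
  edge? p u v = u Subset.∈? p ×-dec v Subset.∈? p ×-dec ¬? (u ≟ v)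

  triangle : Fin n → Fin n → Fin n → SubgraphData n
  triangle a b c =
    ⟨ corners a b c , tabulate (λ u → tabulate (λ v → does (edge? (corners a b c) u v))) ⟩

  ∈triangle : {a b c x : Fin n} → x ∈ SubgraphData.vertices (triangle a b c) ⇔ IsCorner a b c x
  ∈triangle = mk⇔
    (Sum.map (⇒ x∈⁅y⁆⇔x≡y) (Sum.map (⇒ x∈⁅y⁆⇔x≡y) (⇒ x∈⁅y⁆⇔x≡y) ∘ ⇒ ∪⇔⊎) ∘ ⇒ ∪⇔⊎)
    (⇐ ∪⇔⊎ ∘ Sum.map (⇐ x∈⁅y⁆⇔x≡y) (⇐ ∪⇔⊎ ∘ Sum.map (⇐ x∈⁅y⁆⇔x≡y) (⇐ x∈⁅y⁆⇔x≡y)))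

  triangle-complete : {a b c : Fin n} → Complete (triangle a b c)
  triangle-complete {a = a} {b} {c} {u} {v} = mk⇔
    (λ e → does⇒ (edge? _ u v) (trans (sym lookup-edge) ([]=⇒lookup e)))
    (λ e → lookup⇒[]= v _ (trans lookup-edge (dec-true (edge? _ u v) e)))
    where
    lookup-edge : lookup (lookup (SubgraphData.neighbours (triangle a b c)) u) v ≡
      does (edge? (corners a b c) u v)
    lookup-edge = trans (cong (λ row → lookup row v) (lookup∘tabulate _ u)) (lookup∘tabulate _ v)

-- Completeness fixes every row of `neighbours` in terms of the vertex set, including the empty rows
-- of vertices outside it.
complete-unique : {H K : SubgraphData n} → Complete H → Complete K →
  SubgraphData.vertices H ≡ SubgraphData.vertices K → H ≡ K
complete-unique {H = ⟨ p , _ ⟩} {⟨ _ , _ ⟩} H-complete K-complete refl =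
  cong ⟨ p ,_⟩ (vec-ext λ u → ⊆-antisym (⇐ K-complete ∘ ⇒ H-complete) (⇐ H-complete ∘ ⇒ K-complete))

triangle-unique : (H : SubgraphData n) {a b c : Fin n} → Complete H →
  (∀ {x} → x ∈ SubgraphData.vertices H ⇔ IsCorner a b c x) → H ≡ triangle a b c
triangle-unique H H-complete ∈H = complete-unique {H = H} H-complete triangle-complete
  (⊆-antisym (⇐ ∈triangle ∘ ⇒ ∈H) (⇐ ∈H ∘ ⇒ ∈triangle))

triangle-≢ : ∀ {x a b c a′ b′ c′ : Fin n} → IsCorner a b c x →
  x ≢ a′ → x ≢ b′ → x ≢ c′ → triangle a b c ≢ triangle a′ b′ c′
triangle-≢ corner x≢a′ x≢b′ x≢c′ eq =
  [ x≢a′ , [ x≢b′ , x≢c′ ]′ ]′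
    (⇒ ∈triangle (subst (_ ∈_) (cong SubgraphData.vertices eq) (⇐ ∈triangle corner)))

triangle-swap₁₂ : (a b c : Fin n) → triangle a b c ≡ triangle b a c
triangle-swap₁₂ a b c = triangle-unique _ triangle-complete
  (mk⇔ (swap ∘ ⇒ ∈triangle) (⇐ ∈triangle ∘ swap))
  where
  swap : ∀ {a b c x} → IsCorner a b c x → IsCorner b a c x
  swap = [ inj₂ ∘ inj₁ , Sum.map₂ inj₂ ]′

triangle-swap₂₃ : (a b c : Fin n) → triangle a b c ≡ triangle a c b
triangle-swap₂₃ a b c = triangle-unique _ triangle-complete
  (mk⇔ (swap ∘ ⇒ ∈triangle) (⇐ ∈triangle ∘ swap))
  where
  swap : ∀ {a b c x} → IsCorner a b c x → IsCorner a c b x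
  swap = Sum.map₂ Sum.swap

-- The two adjacent transpositions generate all permutations of three corners, so sorting reduces
-- the claim to increasing triples. This serves to enumerate triangles.
wlog₃ : {P : Fin n → Fin n → Fin n → Set} →
  (∀ {a b c} → P a b c → P b a c) → (∀ {a b c} → P a b c → P a c b) →
  (∀ {a b c} → a < b → b < c → P a b c) →
  ∀ {a b c} → a ≢ b → b ≢ c → a ≢ c → P a b c
wlog₃ {P = P} s₁₂ s₂₃ P< {a} {b} {c} a≢b b≢c a≢c with <-cmp a b | <-cmp b c | <-cmp a c
... | tri≈ _ a≡b _ | _ | _ = contradiction a≡b a≢b
... | _ | tri≈ _ b≡c _ | _ = contradiction b≡c b≢c
... | _ | _ | tri≈ _ a≡c _ = contradiction a≡c a≢c
... | tri< a<b _ _ | tri< b<c _ _ | _            = P< a<b b<c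
... | tri< a<b _ _ | tri> _ _ c<b | tri< a<c _ _ = s₂₃ (P< a<c c<b)
... | tri< a<b _ _ | tri> _ _ c<b | tri> _ _ c<a = s₂₃ (s₁₂ (P< c<a a<b))
... | tri> _ _ b<a | tri< b<c _ _ | tri< a<c _ _ = s₁₂ (P< b<a a<c)
... | tri> _ _ b<a | tri< b<c _ _ | tri> _ _ c<a = s₁₂ (s₂₃ (P< b<c c<a))
... | tri> _ _ b<a | tri> _ _ c<b | _            = s₁₂ (s₂₃ (s₁₂ (P< c<b b<a)))

-- Triangles of a graph and pairwise adjacent triples.

module Triangles (G : Graph) where
  open Graph G

  ~⇒≢ : ∀ {u v} → u ~ v → u ≢ v
  ~⇒≢ u~u refl = ~-irrefl _ u~u

  Triangular : Vertex → Vertex → Vertex → Set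
  Triangular a b c = a ~ b × b ~ c × a ~ c

  triangular⇒triangle : ∀ {a b c} → Triangular a b c → IsTriangle G (triangle a b c)
  triangular⇒triangle {a} {b} {c} (a~b , b~c , a~c) = isSubgraph , iso
    where
    corner : Fin 3 → Vertex
    corner = lookup (a ∷ b ∷ c ∷ [])

    corner-~ : ∀ i j → i ≢ j → corner i ~ corner j
    corner-~ 0F 0F i≢j = contradiction refl i≢j
    corner-~ 0F 1F _   = a~b
    corner-~ 0F 2F _   = a~c
    corner-~ 1F 0F _   = ~-sym a~b
    corner-~ 1F 1F i≢j = contradiction refl i≢j
    corner-~ 1F 2F _   = b~c
    corner-~ 2F 0F _   = ~-sym a~c
    corner-~ 2F 1F _   = ~-sym b~c
    corner-~ 2F 2F i≢j = contradiction refl i≢j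

    image⇒ : ∀ {v} → IsCorner a b c v → ∃[ i ] corner i ≡ v
    image⇒ (inj₁ refl)        = 0F , refl
    image⇒ (inj₂ (inj₁ refl)) = 1F , refl
    image⇒ (inj₂ (inj₂ refl)) = 2F , refl

    isCorner : ∀ i → IsCorner a b c (corner i)
    isCorner 0F = inj₁ refl
    isCorner 1F = inj₂ (inj₁ refl)
    isCorner 2F = inj₂ (inj₂ refl)

    corner∈ : ∀ i → corner i ∈ SubgraphData.vertices (triangle a b c)
    corner∈ = ⇐ ∈triangle ∘ isCorner

    edge : Complete (triangle a b c)
    edge = triangle-complete

    edge⇒adjacent : ∀ {u v} → SubgraphData.Edge (triangle a b c) u v → u ~ v
    edge⇒adjacent e with ⇒ edge e
    ... | u∈ , v∈ , u≢v with image⇒ (⇒ ∈triangle u∈) | image⇒ (⇒ ∈triangle v∈)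
    ...   | i , refl | j , refl = corner-~ i j (u≢v ∘ cong corner)

    isSubgraph : IsSubgraph G (triangle a b c)
    isSubgraph = record
      { edge-sym = λ e → let u∈ , v∈ , u≢v = ⇒ edge e in ⇐ edge (v∈ , u∈ , ≢-sym u≢v)
      ; edge⇒∈   = proj₁ ∘ ⇒ edge
      ; edge⇒~   = edge⇒adjacent
      }

    injective : Injective _≡_ _≡_ corner
    injective {i} {j} eq with i ≟ j
    ... | yes i≡j = i≡j
    ... | no  i≢j = contradiction eq (~⇒≢ (corner-~ i j i≢j))

    iso : C₃ ≅ triangle a b c
    iso = record
      { to        = corner
      ; injective = injective
      ; image     = λ v → mk⇔ (image⇒ ∘ ⇒ ∈triangle) λ { (i , refl) → corner∈ i }
      ; edges     = λ i j → mk⇔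
          (λ i≢j → ⇐ edge (corner∈ i , corner∈ j , ~⇒≢ (corner-~ i j i≢j)))
          (λ e i≡j → proj₂ (proj₂ (⇒ edge e)) (cong corner i≡j))
      }

  -- The images of the vertices of `C₃` serve as corners. Since `C₃` joins all distinct vertices,
  -- `H` is complete, hence determined by these corners.
  triangle⇒triangular : ∀ {H} → IsTriangle G H →
    ∃[ a ] ∃[ b ] ∃[ c ] Triangular a b c × H ≡ triangle a b c
  triangle⇒triangular {H} (H⊆G , C₃≅H) =
    to 0F , to 1F , to 2F ,
    (adjacent 0F 1F (λ ()) , adjacent 1F 2F (λ ()) , adjacent 0F 2F (λ ())) ,
    triangle-unique H edge (mk⇔ ∈⇒corner corner⇒∈)
    where
    open SubgraphData H
    open IsSubgraph H⊆G
    open _≅_ C₃≅H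

    adjacent : ∀ i j → i ≢ j → to i ~ to j
    adjacent i j i≢j = edge⇒~ (⇒ (edges i j) i≢j)

    distinct⇒edge : ∀ {u v} → u ∈ vertices × v ∈ vertices × u ≢ v → Edge u v
    distinct⇒edge {u} {v} (u∈ , v∈ , u≢v) with ⇒ (image u) u∈ | ⇒ (image v) v∈
    ... | i , refl | j , refl = ⇒ (edges i j) (u≢v ∘ cong to)

    edge : Complete H
    edge = mk⇔ (λ e → edge⇒∈ e , edge⇒∈ (edge-sym e) , ~⇒≢ (edge⇒~ e)) distinct⇒edge

    ∈⇒corner : ∀ {v} → v ∈ vertices → IsCorner (to 0F) (to 1F) (to 2F) v
    ∈⇒corner {v} v∈ with ⇒ (image v) v∈
    ... | 0F , refl = inj₁ refl
    ... | 1F , refl = inj₂ (inj₁ refl)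
    ... | 2F , refl = inj₂ (inj₂ refl)

    corner⇒∈ : ∀ {v} → IsCorner (to 0F) (to 1F) (to 2F) v → v ∈ vertices
    corner⇒∈ = [ at 0F , [ at 1F , at 2F ]′ ]′
      where
      at : ∀ i {v} → v ≡ to i → v ∈ vertices
      at i refl = ⇐ (image _) (i , refl)

-- Survival of the cop in graphs with one or two triangles.

∈-pigeonhole : {A : Set} {xs : List A} {m : ℕ} → length xs ℕ.< m →
  (f : Fin m → A) → (∀ i → f i List.∈ xs) → ∃₂ λ i j → i < j × f i ≡ f j
∈-pigeonhole {xs = xs} xs<m f f∈xs =
  let i , j , i<j , eq = pigeonhole xs<m (index ∘ f∈xs)
  in i , j , i<j , trans (lookup-index (f∈xs i))
       (trans (cong (List.lookup xs) eq) (sym (lookup-index (f∈xs j))))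

module Evasion (G : Graph) where
  open Graph G

  -- `Safe` concerns positions with the cop to move, her vertex first. Capturing the killer counts
  -- as evading because it ends the game.
  Evades : (Vertex → Vertex → Set) → Vertex → Vertex → Vertex → Set
  Evades Safe c r c′ = Move G c c′ ×
    (c′ ≡ r ⊎ (∀ {r′} → Move G r r′ → r′ ≢ c′ × Safe c′ r′))

  anyMove : ∀ c → ∃ (Move G c)
  anyMove c with any? (c ~?_)
  ... | yes (v , c~v) = v , inj₁ c~v
  ... | no  isolated  = c , inj₂ ((λ w c~w → isolated (w , c~w)) , refl)

  -- The cop keeps `Safe` invariant until she captures, so the killer never makes the first capture.
  -- Decidability lets her strategy test the current position.
  evasion : (Safe : Vertex → Vertex → Set) → Decidable Safe → (start : Vertex) →
    (∀ {r} → r ≢ start → Safe start r) →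
    (∀ {c r} → Safe c r → ∃ (Evades Safe c r)) →
    ¬ KillerWin G
  evasion Safe safe? start safe-start evade (σ , wins) = lost (wins τ)
    where
    respond : ∀ c r → ∃ λ c′ → Move G c c′ × (Safe c r → Evades Safe c r c′)
    respond c r with safe? c r
    ... | yes safe = let c′ , ev = evade safe in c′ , proj₁ ev , λ _ → ev
    -- Strategies are total, so an unsafe position receives an arbitrary legal move. None arises
    -- before the cop captures.
    ... | no ¬safe = let c′ , mv = anyMove c in c′ , mv , λ safe → contradiction safe ¬safe

    τ : CopStrategy G
    τ = record
      { start = start
      ; move  = λ h → let c′ , mv , _ = respond (cop G h) (killer G h) in c′ , mv
      }

    at : ℕ → History G
    at = play G τ σ

    survive : ∀ t → Safe (cop G (at t)) (killer G (at t)) → ¬ CopCaptures G τ σ t →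
      killer G (at (suc t)) ≢ cop G (at (suc t)) ×
      Safe (cop G (at (suc t))) (killer G (at (suc t)))
    survive t safe ¬capture
      with proj₂ (proj₂ (proj₂ (respond (cop G (at t)) (killer G (at t)))) safe)
    ... | inj₁ capture = contradiction capture ¬capture
    ... | inj₂ safe′   = safe′ (proj₂ (KillerStrategy.move σ (at t) (cop G (at (suc t)))))

    safe-until : ∀ t → (∀ s → s ℕ.< t → ¬ CopCaptures G τ σ s) →
      Safe (cop G (at t)) (killer G (at t))
    safe-until zero    _        = safe-start (proj₂ (KillerStrategy.start σ start))
    safe-until (suc t) ¬capture = proj₂ (survive t
      (safe-until t (λ s s<t → ¬capture s (ℕ.m<n⇒m<1+n s<t))) (¬capture t ℕ.≤-refl))

    lost : ¬ KillerWins G τ σ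
    lost (t , killed , ¬capture) =
      proj₁ (survive t (safe-until t λ s s<t → ¬capture s (ℕ.<⇒≤ s<t)) (¬capture t ℕ.≤-refl)) killed

  open Triangles G

  AtMostTwoTriangles : Set
  AtMostTwoTriangles = ∀ {H₁ H₂ H₃} →
    IsTriangle G H₁ → IsTriangle G H₂ → IsTriangle G H₃ →
    H₁ ≢ H₂ → H₁ ≢ H₃ → ¬ H₂ ≢ H₃

  -- For a triangle `abc`, such an `r` is the apex of a second triangle on the side `bc`.
  OtherApex : (a b c r : Vertex) → Set
  OtherApex a b c r = r ≢ a × r ~ b × r ~ c

  otherApex? : ∀ a b c → Dec (∃ (OtherApex a b c))
  otherApex? a b c = any? λ r → ¬? (r ≟ a) ×-dec r ~? b ×-dec r ~? c

  -- The hypothesis `r ≢ v` handles a killer without neighbours, who stays where he is.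
  avoid : ∀ {r r′ v} → ¬ (r ~ v) → r ≢ v → Move G r r′ → r′ ≢ v
  avoid ¬r~v r≢v (inj₁ r~v)        refl = ¬r~v r~v
  avoid ¬r~v r≢v (inj₂ (_ , r′≡r)) refl = r≢v (sym r′≡r)

  triangular-rotate : ∀ {a b c} → Triangular a b c → Triangular b c a
  triangular-rotate (a~b , b~c , a~c) = b~c , ~-sym a~c , ~-sym a~b

  -- A killer who is not adjacent to the cop's corner cannot be adjacent to both other corners, as
  -- he would stand on a second apex. One of the two is therefore out of his reach.
  isolated-triangle : ∀ {a b c} → Triangular a b c →
    ¬ ∃ (OtherApex a b c) → ¬ ∃ (OtherApex b c a) → ¬ ∃ (OtherApex c a b) → ¬ KillerWin G
  isolated-triangle {a} {b} {c} Δ ¬a ¬b ¬c =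
    evasion Safe safe? a (inj₁ refl ,_) evade
    where
    OnTriangle : Vertex → Set
    OnTriangle v = v ≡ a ⊎ v ≡ b ⊎ v ≡ c

    Safe : Vertex → Vertex → Set
    Safe v r = OnTriangle v × r ≢ v

    safe? : Decidable Safe
    safe? v r = (v ≟ a ⊎-dec v ≟ b ⊎-dec v ≟ c) ×-dec ¬? (r ≟ v)

    evade-from : ∀ {x y z r} → Triangular x y z → OnTriangle y → OnTriangle z →
      ¬ ∃ (OtherApex x y z) → r ≢ x → ∃ (Evades Safe x r)
    evade-from {x} {y} {z} {r} (x~y , y~z , x~z) y∈ z∈ ¬apex r≢x with x ~? r | r ~? y
    ... | yes x~r | _      = r , inj₁ x~r , inj₁ refl
    ... | no ¬x~r | no ¬r~y = y , inj₁ x~y , inj₂ λ mv →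
      let r′≢y = avoid ¬r~y (λ { refl → ¬x~r x~y }) mv in r′≢y , y∈ , r′≢y
    ... | no ¬x~r | yes r~y = z , inj₁ x~z , inj₂ λ mv →
      let r′≢z = avoid (λ r~z → ¬apex (r , r≢x , r~y , r~z)) (λ { refl → ¬x~r x~z }) mv
      in r′≢z , z∈ , r′≢z

    evade : ∀ {v r} → Safe v r → ∃ (Evades Safe v r)
    evade (inj₁ refl , r≢v) =
      evade-from Δ (inj₂ (inj₁ refl)) (inj₂ (inj₂ refl)) ¬a r≢v
    evade (inj₂ (inj₁ refl) , r≢v) =
      evade-from (triangular-rotate Δ) (inj₂ (inj₂ refl)) (inj₁ refl) ¬b r≢v
    evade (inj₂ (inj₂ refl) , r≢v) =
      evade-from (triangular-rotate (triangular-rotate Δ)) (inj₁ refl) (inj₂ (inj₁ refl)) ¬c r≢v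

  -- The cop leaves the common side bc only for a, and only when the killer
  -- cannot reach the other apex d in his next move.

  adjacent-triangles : ∀ {a b c} → AtMostTwoTriangles → Triangular a b c →
    ∃ (OtherApex a b c) → ¬ KillerWin G
  adjacent-triangles {a} {b} {c} atMostTwo (a~b , b~c , a~c) (d , d≢a , d~b , d~c) =
    -- Starting on the common side makes every initial vertex of the killer safe; at `a` he could
    -- choose `d`.
    evasion Safe safe? b (λ r≢b → r≢b , inj₁ refl) evade
    where
    Safe : Vertex → Vertex → Set
    Safe v r = r ≢ v × (v ≡ b ⊎ v ≡ c ⊎ (v ≡ a × r ≢ d))

    safe? : Decidable Safe
    safe? v r = ¬? (r ≟ v) ×-dec (v ≟ b ⊎-dec v ≟ c ⊎-dec (v ≟ a ×-dec ¬? (r ≟ d)))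

    evade-from-side : ∀ {y z r} → a ~ y → y ~ z → a ~ z → d ~ y → d ~ z →
      (∀ {r} → r ≢ z → Safe z r) →
      r ≢ y → ∃ (Evades Safe y r)
    evade-from-side {y} {z} {r} a~y y~z a~z d~y d~z safe-z r≢y with y ~? r | r ~? z
    ... | yes y~r | _       = r , inj₁ y~r , inj₁ refl
    ... | no ¬y~r | no ¬r~z = z , inj₁ y~z , inj₂ λ mv →
      let r′≢z = avoid ¬r~z (λ { refl → ¬y~r y~z }) mv in r′≢z , safe-z r′≢z
    -- With `z` attacked, the cop retreats to `a`. The killer must be unable to reach `a`, where he
    -- would capture, and `d`, which would break `Safe`.
    ... | no ¬y~r | yes r~z = a , inj₁ (~-sym a~y) , inj₂ λ mv →
      let r′≢a = avoid (no-triangle-rxz a~y a~z) r≢a mv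
      in r′≢a , r′≢a , inj₂ (inj₂ (refl , avoid (no-triangle-rxz d~y d~z) r≢d mv))
      where
      r≢a : r ≢ a
      r≢a refl = ¬y~r (~-sym a~y)

      r≢d : r ≢ d
      r≢d refl = ¬y~r (~-sym d~y)

      -- Otherwise `r x z` is a third triangle: it misses `y`, which both triangles on the common
      -- side contain.
      no-triangle-rxz : ∀ {x} → x ~ y → x ~ z → ¬ (r ~ x)
      no-triangle-rxz x~y x~z r~x = atMostTwo
        (triangular⇒triangle (a~y , y~z , a~z))
        (triangular⇒triangle (d~y , y~z , d~z))
        (triangular⇒triangle (r~x , x~z , r~z))
        (triangle-≢ (inj₁ refl) (≢-sym d≢a) (~⇒≢ a~y) (~⇒≢ a~z))
        y∉rxz y∉rxz
        where
        y∉rxz : ∀ {w} → triangle w y z ≢ triangle r _ z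
        y∉rxz = triangle-≢ (inj₂ (inj₁ refl)) (≢-sym r≢y) (≢-sym (~⇒≢ x~y)) (~⇒≢ y~z)

    -- Such an `r` would be a third apex on `bc`. The condition `r ≢ d` is what `Safe` grants while
    -- the cop is at `a`.
    no-third-apex : ∀ {r} → r ≢ a → r ≢ d → r ~ b → ¬ (r ~ c)
    no-third-apex r≢a r≢d r~b r~c = atMostTwo
      (triangular⇒triangle (a~b , b~c , a~c))
      (triangular⇒triangle (d~b , b~c , d~c))
      (triangular⇒triangle (r~b , b~c , r~c))
      (triangle-≢ (inj₁ refl) (≢-sym d≢a) (~⇒≢ a~b) (~⇒≢ a~c))
      (triangle-≢ (inj₁ refl) (≢-sym r≢a) (~⇒≢ a~b) (~⇒≢ a~c))
      (triangle-≢ (inj₁ refl) (≢-sym r≢d) (~⇒≢ d~b) (~⇒≢ d~c))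

    evade-from-apex : ∀ {r} → r ≢ a → r ≢ d → ∃ (Evades Safe a r)
    evade-from-apex {r} r≢a r≢d with a ~? r | r ~? b
    ... | yes a~r | _       = r , inj₁ a~r , inj₁ refl
    ... | no ¬a~r | no ¬r~b = b , inj₁ a~b , inj₂ λ mv →
      let r′≢b = avoid ¬r~b (λ { refl → ¬a~r a~b }) mv in r′≢b , r′≢b , inj₁ refl
    ... | no ¬a~r | yes r~b = c , inj₁ a~c , inj₂ λ mv →
      let r′≢c = avoid (no-third-apex r≢a r≢d r~b) (λ { refl → ¬a~r a~c }) mv
      in r′≢c , r′≢c , inj₂ (inj₁ refl)

    evade : ∀ {v r} → Safe v r → ∃ (Evades Safe v r)
    evade (r≢v , inj₁ refl) =
      evade-from-side a~b b~c a~c d~b d~c (λ r≢c → r≢c , inj₂ (inj₁ refl)) r≢v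
    evade (r≢v , inj₂ (inj₁ refl)) =
      evade-from-side a~c (~-sym b~c) a~b d~c d~b (λ r≢b → r≢b , inj₁ refl) r≢v
    evade (r≢v , inj₂ (inj₂ (refl , r≢d))) = evade-from-apex r≢v r≢d

  -- If some side carries a second triangle, rotating `abc` makes it the side opposite the first
  -- corner; otherwise the triangle is isolated.
  fewTriangles⇒¬killerWin : ∀ {a b c} → Triangular a b c → AtMostTwoTriangles → ¬ KillerWin G
  fewTriangles⇒¬killerWin {a} {b} {c} Δ atMostTwo
    with otherApex? a b c | otherApex? b c a | otherApex? c a b
  ... | yes apex | _        | _        = adjacent-triangles atMostTwo Δ apex
  ... | no _     | yes apex | _        = adjacent-triangles atMostTwo (triangular-rotate Δ) apex
  ... | no _     | no _     | yes apex =
    adjacent-triangles atMostTwo (triangular-rotate (triangular-rotate Δ)) apex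
  ... | no ¬a    | no ¬b    | no ¬c    = isolated-triangle Δ ¬a ¬b ¬c

  -- Three distinct triangles cannot share fewer than three list positions.
  count<3⇒atMostTwo : ∀ {k} → HasExactlyTriangles G k → k ℕ.< 3 → AtMostTwoTriangles
  count<3⇒atMostTwo (ts , _ , refl , complete) k<3 {H₁} {H₂} {H₃} Δ₁ Δ₂ Δ₃ H₁≢H₂ H₁≢H₃ H₂≢H₃ =
    distinct (∈-pigeonhole k<3 H λ i → ⇐ (complete (H i)) (isTriangle i))
    where
    H : Fin 3 → SubgraphData order
    H = lookup (H₁ ∷ H₂ ∷ H₃ ∷ [])

    isTriangle : ∀ i → IsTriangle G (H i)
    isTriangle 0F = Δ₁
    isTriangle 1F = Δ₂
    isTriangle 2F = Δ₃

    distinct : ¬ (∃₂ λ i j → i < j × H i ≡ H j)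
    distinct (0F , 1F , _ , eq) = H₁≢H₂ eq
    distinct (0F , 2F , _ , eq) = H₁≢H₃ eq
    distinct (1F , 2F , _ , eq) = H₂≢H₃ eq
    distinct (1F , 1F , s≤s () , _)
    distinct (2F , 1F , s≤s () , _)
    distinct (2F , 2F , s≤s (s≤s ()) , _)

  killerWin⇒count : ∀ {k} → KillerWin G → HasExactlyTriangles G k → k ≡ 0 ⊎ k ≥ 3
  killerWin⇒count _ ([] , _ , refl , _) = inj₁ refl
  killerWin⇒count {k} win count@(H ∷ _ , _ , _ , complete) with 3 ℕ.≤? k
  ... | yes 3≤k = inj₂ 3≤k
  ... | no  3≰k =
    let a , b , c , Δ , _ = triangle⇒triangular (⇒ (complete H) (here refl))
    in contradiction win (fewTriangles⇒¬killerWin Δ (count<3⇒atMostTwo count (ℕ.≰⇒> 3≰k)))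

-- Bounded pursuits by the killer, and their transfer to graphs with twins.

module _ (G : Graph) where
  open Graph G

  -- The killer captures within the given number of rounds, the cop being about to move. The bound
  -- makes this decidable by search, so concrete pursuits are verified by evaluation.
  Forced : (respond : Vertex → Vertex → Vertex) → ℕ → Vertex → Vertex → Set
  Forced respond zero    c r = ⊥
  Forced respond (suc t) c r = ∀ c′ → c ~ c′ →
    c′ ≢ r × (r ~ c′ ⊎ Forced respond t c′ (respond r c′))

  forced? : ∀ respond t → Decidable (Forced respond t)
  forced? respond zero    c r = no λ ()
  forced? respond (suc t) c r = all? λ c′ → c ~? c′ →-dec
    (¬? (c′ ≟ r) ×-dec (r ~? c′ ⊎-dec forced? respond t c′ (respond r c′)))

  record Pursuit : Set where
    field
      rounds  : ℕ
      start   : Vertex → Vertex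
      respond : Vertex → Vertex → Vertex
      apart   : ∀ c → start c ≢ c
      legal   : ∀ r c → r ~ respond r c
      forced  : ∀ c → Forced respond rounds c (start c)

  -- The killer captures whenever he can and otherwise follows `respond`; each round without capture
  -- uses up one level of `Forced`.
  pursuit⇒killerWin : Pursuit → KillerWin G
  pursuit⇒killerWin P = σ , λ τ → wins τ rounds 0 (forced _) λ _ ()
    where
    open Pursuit P

    reply : ∀ r c → ∃ (Move G r)
    reply r c with r ~? c
    ... | yes r~c = c , inj₁ r~c
    ... | no  _   = respond r c , inj₁ (legal r c)

    reply-capture : ∀ {r c} → r ~ c → proj₁ (reply r c) ≡ c
    reply-capture {r} {c} r~c with r ~? c
    ... | yes _   = refl
    ... | no ¬r~c = contradiction r~c ¬r~c

    reply-respond : ∀ {r c} → ¬ (r ~ c) → proj₁ (reply r c) ≡ respond r c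
    reply-respond {r} {c} ¬r~c with r ~? c
    ... | yes r~c = contradiction r~c ¬r~c
    ... | no _    = refl

    move⇒~ : ∀ {u v} → Move G u v → u ~ v
    move⇒~ (inj₁ u~v) = u~v
    -- `legal` gives every vertex a neighbour, so nobody, the cop included, ever stays put.
    move⇒~ {u} (inj₂ (isolated , _)) = contradiction (legal u u) (isolated (respond u u))

    σ : KillerStrategy G
    σ = record
      { start = λ c → start c , apart c
      ; move  = λ h c → reply (killer G h) c
      }

    module _ (τ : CopStrategy G) where

      at : ℕ → History G
      at = play G τ σ

      wins : ∀ n t → Forced respond n (cop G (at t)) (killer G (at t)) →
        (∀ s → s ℕ.< t → ¬ CopCaptures G τ σ s) → KillerWins G τ σ
      wins (suc n) t force ¬captured = continue (r ~? c)
        where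
        r c : Vertex
        r = killer G (at t)
        c = cop G (at (suc t))

        forced-move : c ≢ r × (r ~ c ⊎ Forced respond n c (respond r c))
        forced-move = force c (move⇒~ (proj₂ (CopStrategy.move τ (at t))))

        -- The cop moves before the killer in round `t` too, so this round must be covered as well.
        ¬captured′ : ∀ s → s ℕ.< suc t → ¬ CopCaptures G τ σ s
        ¬captured′ s s<1+t with ℕ.m<1+n⇒m<n∨m≡n s<1+t
        ... | inj₁ s<t  = ¬captured s s<t
        ... | inj₂ refl = proj₁ forced-move

        continue : Dec (r ~ c) → KillerWins G τ σ
        continue (yes r~c) = t , reply-capture r~c , λ s s≤t → ¬captured′ s (s≤s s≤t)
        continue (no ¬r~c) = wins n (suc t)
          (subst (Forced respond n c) (sym (reply-respond ¬r~c))
            ([ (λ r~c → contradiction r~c ¬r~c) , id ]′ (proj₂ forced-move)))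
          ¬captured′

  -- Vertices with the same image under π are nonadjacent twins.

  pullback : ∀ {n} → (Fin (suc n) → Vertex) → Graph
  pullback {n} π = record
    { order    = suc n
    ; nonEmpty = _
    ; _~_      = λ u v → π u ~ π v
    ; _~?_     = λ u v → π u ~? π v
    ; ~-sym    = ~-sym
    ; ~-irrefl = ~-irrefl ∘ π
    }

module _ (G : Graph) where
  open Graph G

  -- Until he captures, the killer stays in the image of the section `ι` and copies the pursuit of
  -- the projected cop. A capture by the cop would project to one in `G`.
  pullback-pursuit : ∀ {n} (π : Fin (suc n) → Vertex) (ι : Vertex → Fin (suc n)) →
    (∀ v → π (ι v) ≡ v) → Pursuit G → Pursuit (pullback G π)
  pullback-pursuit {n} π ι π∘ι P = record
    { rounds  = rounds
    ; start   = ι ∘ start ∘ π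
    ; respond = respond′
    ; apart   = λ c eq → apart (π c) (trans (sym (π∘ι _)) (cong π eq))
    ; legal   = λ r c → subst (π r ~_) (sym (π∘ι _)) (legal (π r) (π c))
    ; forced  = λ c → lift rounds
        (subst (Forced G respond rounds (π c)) (sym (π∘ι _)) (forced (π c)))
    }
    where
    open Pursuit P

    respond′ : Fin (suc n) → Fin (suc n) → Fin (suc n)
    respond′ r c = ι (respond (π r) (π c))

    lift : ∀ t {c r} → Forced G respond t (π c) (π r) → Forced (pullback G π) respond′ t c r
    lift (suc t) force c′ c~c′ =
      let c′≢r , alternative = force (π c′) c~c′
      in c′≢r ∘ cong π ,
         Sum.map₂ (lift t ∘ subst (Forced G respond t (π c′)) (sym (π∘ι _))) alternative

-- The two base graphs: a path and a wheel lacking a spoke.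

module _ {n : ℕ} where

  open DecMembership (≡-dec (_≟_ {suc n}) (_≟_ {suc n})) using (_∈?_)

  fromEdges : (es : List (Fin (suc n) × Fin (suc n))) → All (λ (u , v) → u ≢ v) es → Graph
  fromEdges es loopless = record
    { order    = suc n
    ; nonEmpty = _
    ; _~_      = λ u v → (u , v) List.∈ es ⊎ (v , u) List.∈ es
    ; _~?_     = λ u v → (u , v) ∈? es ⊎-dec (v , u) ∈? es
    ; ~-sym    = Sum.swap
    ; ~-irrefl = λ v → [ loop , loop ]′
    }
    where
    loop : ∀ {v} → ¬ ((v , v) List.∈ es)
    loop v~v = All.lookup loopless v~v refl

module Path where

  P₄ : Graph
  P₄ = fromEdges es (from-yes (All.all? (λ (u , v) → ¬? (u ≟ v)) es))
    where
    es : List (Fin 4 × Fin 4)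
    es = (0F , 1F) ∷ (1F , 2F) ∷ (2F , 3F) ∷ []

  open Graph P₄
  open Triangles P₄

  -- The killer starts at distance two. A cop who approaches is captured at once; one who retreats
  -- to an end is followed and must come back in the second round.
  pursuit : Pursuit P₄
  pursuit = record
    { rounds  = 2
    ; start   = start
    ; respond = respond
    ; apart   = from-yes (all? λ c → ¬? (start c ≟ c))
    ; legal   = from-yes (all? λ r → all? λ c → r ~? respond r c)
    ; forced  = from-yes (all? λ c → forced? P₄ respond 2 c (start c))
    }
    where
    start : Vertex → Vertex
    start 0F = 2F
    start 1F = 3F
    start 2F = 0F
    start 3F = 1F

    respond : Vertex → Vertex → Vertex
    respond 0F _ = 1F
    respond 1F _ = 0F
    respond 2F _ = 1F
    respond 3F _ = 2F

  triangle-free : ∀ a b c → ¬ Triangular a b c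
  triangle-free = from-yes (all? λ a → all? λ b → all? λ c →
    ¬? (a ~? b ×-dec b ~? c ×-dec a ~? c))

  count : HasExactlyTriangles P₄ 0
  count = [] , [] , refl , λ H → mk⇔ (λ ()) λ Δ →
    let _ , _ , _ , abc , _ = triangle⇒triangular Δ in contradiction abc (triangle-free _ _ _)

-- The wheel with hub 0 and rim 1 2 3 5 4, without the spoke to 4.

module Wheel where

  W : Graph
  W = fromEdges es (from-yes (All.all? (λ (u , v) → ¬? (u ≟ v)) es))
    where
    es : List (Fin 6 × Fin 6)
    es = (0F , 1F) ∷ (0F , 2F) ∷ (0F , 3F) ∷ (0F , 5F) ∷
         (1F , 2F) ∷ (2F , 3F) ∷ (3F , 5F) ∷ (5F , 4F) ∷ (4F , 1F) ∷ []

  open Graph W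
  open Triangles W

  -- Each noncapturing reply leaves the killer nonadjacent to the cop. The longest line, cop first,
  -- is (0,4), (2,5), (1,3), (4,0), up to the reflection exchanging 1 with 5 and 2 with 3. At the
  -- end both exits from 4 are adjacent to the hub, so the fourth round captures.
  pursuit : Pursuit W
  pursuit = record
    { rounds  = 4
    ; start   = start
    ; respond = respond
    ; apart   = from-yes (all? λ c → ¬? (start c ≟ c))
    ; legal   = from-yes (all? λ r → all? λ c → r ~? respond r c)
    ; forced  = from-yes (all? λ c → forced? W respond 4 c (start c))
    }
    where
    start : Vertex → Vertex
    start 0F = 4F
    start 1F = 3F
    start 2F = 5F
    start 3F = 1F
    start 4F = 0F
    start 5F = 2F

    respond : Vertex → Vertex → Vertex
    respond 0F _  = 1F
    respond 1F 5F = 2F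
    respond 1F _  = 0F
    respond 2F _  = 0F
    respond 3F _  = 0F
    respond 4F 2F = 5F
    respond 4F _  = 1F
    respond 5F 1F = 3F
    respond 5F _  = 0F

  open DecMembership (≡-dec (_≟_ {6}) (≡-dec (_≟_ {6}) (_≟_ {6}))) using (_∈?_)

  triples : List (Vertex × Vertex × Vertex)
  triples = (0F , 1F , 2F) ∷ (0F , 2F , 3F) ∷ (0F , 3F , 5F) ∷ []

  increasing-triangles : ∀ a b c → a < b → b < c → Triangular a b c → (a , b , c) List.∈ triples
  increasing-triangles = from-yes (all? λ a → all? λ b → all? λ c →
    a <? b →-dec b <? c →-dec (a ~? b ×-dec b ~? c ×-dec a ~? c) →-dec (a , b , c) ∈? triples)

-- Merging the twins of the last vertex.

module _ {m : ℕ} where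

  -- All vertices from position `p` onwards are merged into the last one. Placing the twins last
  -- makes the map monotone, so increasing triples can be compared.
  collapse : ∀ p → Fin (p + suc m) → Fin (suc p)
  collapse zero    _       = zero
  collapse (suc p) zero    = zero
  collapse (suc p) (suc i) = suc (collapse p i)

  embed : ∀ p → Fin (suc p) → Fin (p + suc m)
  embed zero    zero    = zero
  embed (suc p) zero    = zero
  embed (suc p) (suc i) = suc (embed p i)

  collapse-embed : ∀ p i → collapse p (embed p i) ≡ i
  collapse-embed zero    zero    = refl
  collapse-embed (suc p) zero    = refl
  collapse-embed (suc p) (suc i) = cong suc (collapse-embed p i)

  collapse-mono : ∀ p {i j} → i ≤ j → collapse p i ≤ collapse p j
  collapse-mono zero    _                           = z≤n
  collapse-mono (suc p) {zero}          _           = z≤n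
  collapse-mono (suc p) {suc i} {suc j} (s≤s i≤j) = s≤s (collapse-mono p i≤j)

  -- Fibres over all but the last vertex are singletons, so a corner there is determined by its
  -- image.
  collapse-inject₁⁻ : ∀ p {i} (j : Fin p) → collapse p i ≡ inject₁ j → i ≡ j ↑ˡ suc m
  collapse-inject₁⁻ (suc p) {zero}  zero    _  = refl
  collapse-inject₁⁻ (suc p) {suc i} (suc j) eq = cong suc (collapse-inject₁⁻ p j (suc-injective eq))

  collapse-fromℕ⁻ : ∀ p {i} → collapse p i ≡ fromℕ p → ∃ λ j → i ≡ p ↑ʳ j
  collapse-fromℕ⁻ zero    {i}     _  = i , refl
  collapse-fromℕ⁻ (suc p) {suc i} eq =
    let j , i≡p↑ʳj = collapse-fromℕ⁻ p (suc-injective eq) in j , cong suc i≡p↑ʳj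

-- Counting the triangles of the wheel with twins.

module Fan (m : ℕ) where

  G : Graph
  G = pullback Wheel.W (collapse {m} 5)

  killerWin : KillerWin G
  killerWin = pursuit⇒killerWin G
    (pullback-pursuit Wheel.W (collapse 5) (embed 5) (collapse-embed 5) Wheel.pursuit)

  open Graph G
  open Triangles G

  twin : Fin (suc m) → Vertex
  twin = 5 ↑ʳ_

  twinTriangle : Fin (suc m) → SubgraphData order
  twinTriangle j = triangle 0F 3F (twin j)

  ts : List (SubgraphData order)
  ts = triangle 0F 1F 2F ∷ triangle 0F 2F 3F ∷ List.tabulate twinTriangle

  -- Each entry has a corner missing from all later ones: first 1, then 2, then the twin itself.
  ts-unique : Unique ts
  ts-unique =
    (triangle-≢ (inj₂ (inj₁ refl)) (λ ()) (λ ()) (λ ()) ∷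
      All.tabulate⁺ {f = twinTriangle} λ j → triangle-≢ (inj₂ (inj₁ refl)) (λ ()) (λ ()) (λ ())) ∷
    All.tabulate⁺ {f = twinTriangle} (λ j → triangle-≢ (inj₂ (inj₁ refl)) (λ ()) (λ ()) (λ ())) ∷
    Unique.tabulate⁺ {f = twinTriangle} λ {i} {j} eq → decidable-stable (i ≟ j) λ i≢j →
      triangle-≢ {x = twin i} (inj₂ (inj₂ refl)) (λ ()) (λ ()) (i≢j ∘ ↑ʳ-injective 5 i j) eq

  listed⇒triangle : ∀ {H} → H List.∈ ts → IsTriangle G H
  listed⇒triangle (here refl) =
    triangular⇒triangle (from-yes (0F ~? 1F) , from-yes (1F ~? 2F) , from-yes (0F ~? 2F))
  listed⇒triangle (there (here refl)) =
    triangular⇒triangle (from-yes (0F ~? 2F) , from-yes (2F ~? 3F) , from-yes (0F ~? 3F))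
  listed⇒triangle (there (there H∈)) with List.∈-tabulate⁻ {f = twinTriangle} H∈
  ... | j , refl =
    triangular⇒triangle (from-yes (0F ~? 3F) , from-yes (3F ~? twin j) , from-yes (0F ~? twin j))

  Listed : Vertex → Vertex → Vertex → Set
  Listed a b c = Triangular a b c → triangle a b c List.∈ ts

  -- Monotonicity gives the weak inequality; adjacent vertices have distinct images because the
  -- wheel has no loops.
  collapse-< : ∀ {a b} → a < b → a ~ b → collapse 5 a < collapse 5 b
  collapse-< a<b a~b = ≤∧≢⇒< (collapse-mono 5 (ℕ.<⇒≤ a<b)) (Triangles.~⇒≢ Wheel.W a~b)

  -- The variable `t` allows matching on membership in `triples`. Fibres then determine the corners,
  -- with a choice of twin only over vertex 5.
  increasing-listed′ : ∀ {a b c} {t : Fin 6 × Fin 6 × Fin 6} →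
    (collapse 5 a , collapse 5 b , collapse 5 c) ≡ t → t List.∈ Wheel.triples →
    triangle a b c List.∈ ts
  increasing-listed′ abc≡ (here refl)
    with refl ← collapse-inject₁⁻ 5 0F (cong proj₁ abc≡)
       | refl ← collapse-inject₁⁻ 5 1F (cong (proj₁ ∘ proj₂) abc≡)
       | refl ← collapse-inject₁⁻ 5 2F (cong (proj₂ ∘ proj₂) abc≡) = here refl
  increasing-listed′ abc≡ (there (here refl))
    with refl ← collapse-inject₁⁻ 5 0F (cong proj₁ abc≡)
       | refl ← collapse-inject₁⁻ 5 2F (cong (proj₁ ∘ proj₂) abc≡)
       | refl ← collapse-inject₁⁻ 5 3F (cong (proj₂ ∘ proj₂) abc≡) = there (here refl)
  increasing-listed′ abc≡ (there (there (here refl)))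
    with refl ← collapse-inject₁⁻ 5 0F (cong proj₁ abc≡)
       | refl ← collapse-inject₁⁻ 5 3F (cong (proj₁ ∘ proj₂) abc≡)
       | j , refl ← collapse-fromℕ⁻ 5 (cong (proj₂ ∘ proj₂) abc≡) =
    there (there (List.∈-tabulate⁺ {f = twinTriangle} j))

  increasing-listed : ∀ {a b c} → a < b → b < c → Listed a b c
  increasing-listed {a} {b} {c} a<b b<c Δ@(a~b , b~c , _) = increasing-listed′ refl
    (Wheel.increasing-triangles _ _ _ (collapse-< a<b a~b) (collapse-< b<c b~c) Δ)

  listed : ∀ {a b c} → Listed a b c
  listed {a} {b} {c} Δ@(a~b , b~c , a~c) = wlog₃ {P = Listed}
    (λ {a} {b} {c} l (b~a , a~c , b~c) →
      subst (List._∈ ts) (triangle-swap₁₂ a b c) (l (~-sym b~a , b~c , a~c)))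
    (λ {a} {b} {c} l (a~c , c~b , a~b) →
      subst (List._∈ ts) (triangle-swap₂₃ a b c) (l (a~b , ~-sym c~b , a~c)))
    increasing-listed (~⇒≢ a~b) (~⇒≢ b~c) (~⇒≢ a~c) Δ

  count : HasExactlyTriangles G (3 + m)
  count = ts , ts-unique , cong (2 +_) (length-tabulate twinTriangle) ,
    λ H → mk⇔ listed⇒triangle λ H-triangle →
      let a , b , c , Δ , H≡ = triangle⇒triangular H-triangle
      in subst (List._∈ ts) (sym H≡) (listed Δ)

-- The admissible numbers of triangles.

realisable : ∀ {k} → k ≡ 0 ⊎ k ≥ 3 → ∃[ G ] KillerWin G × HasExactlyTriangles G k
realisable (inj₁ refl) = Path.P₄ , pursuit⇒killerWin Path.P₄ Path.pursuit , Path.count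
-- Here `k` is `3 + m`: each of the `suc m` twins lies in one triangle, and two triangles contain no
-- twin.
realisable (inj₂ (s≤s (s≤s (s≤s {n = m} z≤n)))) = Fan.G m , Fan.killerWin m , Fan.count m

lemma4 : (k : ℕ) → (∃[ G ] KillerWin G × HasExactlyTriangles G k) ⇔ (k ≡ 0 ⊎ k ≥ 3)
lemma4 k = mk⇔ (λ (G , win , count) → Evasion.killerWin⇒count G win count) realisable
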